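{- Let $q$ be a prime power and suppose there exists a linear $(2,t_o,s,q)$-AONT with $2\le t_o$. Then \[ s\le \max\{\,1+(t_o-2)(q+1),\; 2+(t_o-1)(q-1)\,\}.\]
   Context: A linear $(t_i,t_o,s,q)$-AONT is given by an invertible $s\times s$ matrix $M$ over $\mathbb{F}_q$ defining the map $\mathbf{x}\mapsto\mathbf{y}=\mathbf{x}M^{ -1}$ on row vectors of $\mathbb{F}_q^s$, such that for every set $I$ of $t_i$ input coordinates and every set $J$ of $s-t_o$ output coordinates, the pair $((x_i)_{i\in I},(y_j)_{j\in J})$ takes every value in $\mathbb{F}_q^{t_i+s-t_o}$ equally often as $\mathbf{x}$ ranges over $\mathbb{F}_q^s$. Equivalently, $M$ is invertible and every $t_o\times t_i$ submatrix of $M$ has rank $t_i$. -}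

module Defs where

open import Algebra.Bundles using (CommutativeRing)
open import Data.Fin.Base using (Fin)
open import Data.Fin.Properties using (_≟_)
open import Data.Fin.Subset using (Subset; _∈_; ∣_∣)
open import Data.Nat.Base using (ℕ; _≤_; _∸_; _^_)
open import Data.Nat.Primality using (Prime)
open import Data.Product.Base using (Σ-syntax; ∃-syntax; _×_; proj₁)
open import Data.Vec.Functional using (Vector)
import Data.Vec.Functional.Relation.Binary.Equality.Setoid as VecEq
open import Function.Bundles using (Inverse)
open import Level using (Level; suc; _⊔_)
open import Relation.Binary.Bundles using (Setoid)
import Relation.Binary.Construct.On as On
open import Relation.Binary.PropositionalEquality using (_≡_; setoid)
open import Relation.Nullary.Decidable.Core using (yes; no)
open import Relation.Nullary.Negation.Core using (¬_)
import Algebra.Properties.Semiring.Sum as Sum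

IsPrimePower : ℕ → Set
IsPrimePower q = ∃[ p ] ∃[ k ] (Prime p × 1 ≤ k × q ≡ p ^ k)

HasCardinality : ∀ {a ℓ} → Setoid a ℓ → ℕ → Set (a ⊔ ℓ)
HasCardinality S n = Inverse S (setoid (Fin n))

record FiniteField (c ℓ : Level) (q : ℕ) : Set (suc (c ⊔ ℓ)) where
  field
    commutativeRing : CommutativeRing c ℓ

  open CommutativeRing commutativeRing public

  field
    0≉1         : ¬ (0# ≈ 1#)
    inverse     : ∀ x → ¬ (x ≈ 0#) → ∃[ y ] (x * y ≈ 1#)
    cardinality : HasCardinality (CommutativeRing.setoid commutativeRing) q

module _ {c ℓ : Level} {q : ℕ} (F : FiniteField c ℓ q) where

  private
    module F = FiniteField F
  open F using (Carrier; _≈_; _*_; 0#; 1#)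
  open Sum F.semiring using (sum)

  Matrix : ℕ → ℕ → Set c
  Matrix m n = Fin m → Fin n → Carrier

  identityMatrix : ∀ n → Matrix n n
  identityMatrix n i j with i ≟ j
  ... | yes _ = 1#
  ... | no  _ = 0#

  vecMul : ∀ {m n} → Vector Carrier m → Matrix m n → Vector Carrier n
  vecMul x A j = sum (λ i → x i * A i j)

  matMul : ∀ {l m n} → Matrix l m → Matrix m n → Matrix l n
  matMul A B i = vecMul (A i) B

  -- An element of 𝔽_q^I for a set I of coordinates.
  Values : ∀ {s} → Subset s → Set c
  Values {s} I = (i : Fin s) → i ∈ I → Carrier

  -- The input vectors x for which (x_i)_{i ∈ I} = a and (y_j)_{j ∈ J} = b,
  -- where y = x N.
  Fibre : ∀ {s} → Matrix s s → (I J : Subset s) → Values I → Values J →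
          Setoid (c ⊔ ℓ) ℓ
  Fibre {s} N I J a b = On.setoid {B = Solution} (VecEq.≋-setoid F.setoid s) proj₁
    where
    Solution : Set (c ⊔ ℓ)
    Solution = Σ[ x ∈ Vector Carrier s ]
      (∀ i (i∈I : i ∈ I) → x i ≈ a i i∈I) ×
      (∀ j (j∈J : j ∈ J) → vecMul x N j ≈ b j j∈J)

  EquallyOften : ∀ {s} → Matrix s s → (I J : Subset s) → Set (c ⊔ ℓ)
  EquallyOften N I J =
    ∃[ μ ] (∀ (a : Values I) (b : Values J) → HasCardinality (Fibre N I J a b) μ)

  record LinearAONT (tᵢ tₒ s : ℕ) : Set (c ⊔ ℓ) where
    field
      tᵢ≤s     : tᵢ ≤ s
      tₒ≤s     : tₒ ≤ s
      M        : Matrix s s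
      M⁻¹      : Matrix s s
      inverseˡ : ∀ i j → matMul M⁻¹ M i j ≈ identityMatrix s i j
      inverseʳ : ∀ i j → matMul M M⁻¹ i j ≈ identityMatrix s i j
      unbiased : ∀ (I J : Subset s) → ∣ I ∣ ≡ tᵢ → ∣ J ∣ ≡ s ∸ tₒ →
                 EquallyOften M⁻¹ I J

{-# OPTIONS --safe #-}
module Submission where

-- Fix two columns of M. A functional (u , v) ≠ 0 kills at most tₒ − 1 rows of the resulting s × 2
-- matrix, for otherwise tₒ of its rows would have rank at most 1. Up to scaling there are q + 1
-- functionals; each row is killed by at least one of them and a zero row by all of them. Summing
-- over the functionals, a zero row gives s + q ≤ (q + 1)(tₒ − 1), the first bound. If no two columns
-- have a zero row, then every row of M has at most one zero, so M has at most s zeros and some two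
-- columns have at most two zeros together. The two coordinate functionals kill exactly these, and
-- the q − 1 others at most tₒ − 1 rows each, which is the second bound.

open import Defs
open import Data.Bool.Base using (if_then_else_)
open import Data.Empty using (⊥)
open import Data.Fin.Base using (Fin; zero; suc; punchIn)
open import Data.Fin.Properties using (_≟_; any?; punchInᵢ≢i)
open import Data.Fin.Subset using (Subset; inside; outside; _∈_; ∣_∣; ∁; ⁅_⁆)
open import Data.Fin.Subset.Properties using (_∈?_; ∣⁅x⁆∣≡1; x∈⁅x⁆; ∣∁p∣≡n∸∣p∣; x∉p⇒x∈∁p)
open import Data.Nat.Base using (ℕ; zero; suc; _+_; _*_; _∸_; _≤_; _<_; _⊔_; z≤n; s≤s)
open import Data.Nat.Properties using (+-0-commutativeMonoid; ≤-refl; ≤-reflexive; ≤-trans;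
  ≤-pred; <⇒≤pred; ≰⇒>; m≤n+m; +-assoc; +-comm; +-identityʳ; *-comm; *-identityʳ; +-mono-≤;
  +-monoˡ-≤; +-monoʳ-≤; +-cancelˡ-≤; m≤m+n; m≤n⇒m≤n⊔o; m≤n⇒m≤o⊔n; _≤?_; <⇒≱; module ≤-Reasoning)
open import Data.Nat.Tactic.RingSolver using (solve-∀)
open import Data.Product.Base using (∃-syntax; _×_; _,_)
open import Data.Vec.Base using ([]; _∷_; here; there)
open import Data.Vec.Functional using (removeAt)
open import Function.Base using (_∘_)
open import Function.Bundles using (Injection; Inverse)
open import Function.Properties.Inverse using (Inverse⇒Injection)
open import Level using (Level)
open import Relation.Binary.PropositionalEquality as ≡ using (_≡_; _≢_)
open import Relation.Nullary.Decidable using (Dec; yes; no; does; map′; ¬?; _×-dec_; dec-true;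
  dec-false)
open import Relation.Nullary.Negation using (¬_; contradiction)
open import Relation.Unary using (Pred; Decidable)
import Algebra.Properties.CommutativeMonoid.Sum as CommutativeMonoidSum
import Algebra.Properties.Ring as RingProperties
import Algebra.Properties.Semiring.Sum as SemiringSum
import Relation.Binary.Reasoning.Setoid as SetoidReasoning

-- Finite sums and counting

open CommutativeMonoidSum +-0-commutativeMonoid using () renaming (sum to Σℕ;
  sum-remove to Σℕ-remove; ∑-comm to Σℕ-comm)

Σℕ-mono : ∀ {n} {f g : Fin n → ℕ} → (∀ i → f i ≤ g i) → Σℕ f ≤ Σℕ g
Σℕ-mono {zero}  f≤g = z≤n
Σℕ-mono {suc n} f≤g = +-mono-≤ (f≤g zero) (Σℕ-mono (f≤g ∘ suc))

Σℕ-upper : ∀ {n} {f : Fin n → ℕ} {b} → (∀ i → f i ≤ b) → Σℕ f ≤ n * b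
Σℕ-upper {zero}  f≤b = z≤n
Σℕ-upper {suc n} f≤b = +-mono-≤ (f≤b zero) (Σℕ-upper (f≤b ∘ suc))

Σℕ-lower : ∀ {n} {f : Fin n → ℕ} {b} → (∀ i → b ≤ f i) → n * b ≤ Σℕ f
Σℕ-lower {zero}  b≤f = z≤n
Σℕ-lower {suc n} b≤f = +-mono-≤ (b≤f zero) (Σℕ-lower (b≤f ∘ suc))

-- Keeps one distinguished term exact and bounds only the others by `b`. It serves to single out a
-- coordinate functional, whose count is a number of zeros in a column.
Σℕ-upper-at : ∀ {n} {f : Fin n → ℕ} {b} i → (∀ j → f j ≤ b) → Σℕ f ≤ f i + (n ∸ 1) * b
Σℕ-upper-at {suc n} {f} i f≤b =
  ≤-trans (≤-reflexive (Σℕ-remove {i = i} f)) (+-monoʳ-≤ (f i) (Σℕ-upper (f≤b ∘ punchIn i)))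

-- One large term adds its excess `m` to the trivial bound `n`. The large term will be the zero row,
-- with excess `q`.
Σℕ-lower-at : ∀ {n} {f : Fin n → ℕ} {m} i → (∀ j → 1 ≤ f j) → suc m ≤ f i → n + m ≤ Σℕ f
Σℕ-lower-at {suc n} {f} {m} i 1≤f m<fi = begin
  suc n + m               ≡⟨ ≡.cong suc (+-comm n m) ⟩
  suc m + n               ≡⟨ ≡.cong (suc m +_) (*-identityʳ n) ⟨
  suc m + n * 1           ≤⟨ +-mono-≤ m<fi (Σℕ-lower (1≤f ∘ punchIn i)) ⟩
  f i + Σℕ (removeAt f i) ≡⟨ Σℕ-remove {i = i} f ⟨
  Σℕ f                    ∎
  where open ≤-Reasoning

term≤Σℕ : ∀ {n} (f : Fin n → ℕ) i → f i ≤ Σℕ f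
term≤Σℕ {suc n} f i = ≤-trans (m≤m+n (f i) _) (≤-reflexive (≡.sym (Σℕ-remove {i = i} f)))

pair-with-small-sum : ∀ {m} (f : Fin (2 + m) → ℕ) → Σℕ f ≤ 2 + m →
  ∃[ i ] ∃[ j ] (i ≢ j × f i + f j ≤ 2)
pair-with-small-sum {zero} f Σf≤2 =
  zero , suc zero , (λ ()) , ≤-trans (≤-reflexive (≡.cong (f zero +_) (≡.sym (+-identityʳ _)))) Σf≤2
pair-with-small-sum {suc m} f Σf≤n with f zero in f₀≡
... | suc k with pair-with-small-sum (f ∘ suc) (≤-trans (m≤n+m _ k) (≤-pred Σf≤n))
...   | i , j , i≢j , fi+fj≤2 = suc i , suc j , (λ { ≡.refl → i≢j ≡.refl }) , fi+fj≤2
pair-with-small-sum {suc m} f Σf≤n | zero with any? (λ j → f (suc j) ≤? 2)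
... | yes (j , fj≤2) = zero , suc j , (λ ()) , ≡.subst (λ z → z + f (suc j) ≤ 2) (≡.sym f₀≡) fj≤2
-- Here the tail alone sums to at least `(2 + m) * 3`, which exceeds the allowed total `3 + m`.
... | no  fj≰2 = contradiction (≤-trans (Σℕ-lower (λ j → ≰⇒> (λ fj≤2 → fj≰2 (j , fj≤2)))) Σf≤n)
                   (<⇒≱ (≤-trans (m≤m+n (4 + m) (2 + 2 * m)) (≤-reflexive (identity m))))
  where
  identity : ∀ m → (4 + m) + (2 + 2 * m) ≡ (2 + m) * 3
  identity = solve-∀

indicator : ∀ {p} {P : Set p} → Dec P → ℕ
indicator P? = if does P? then 1 else 0

indicator-mono : ∀ {p r} {P : Set p} {R : Set r} (P? : Dec P) (R? : Dec R) →
  (P → R) → indicator P? ≤ indicator R?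
indicator-mono (no _)  R?      P⇒R = z≤n
indicator-mono (yes p) (yes _) P⇒R = ≤-refl
indicator-mono (yes p) (no ¬r) P⇒R = contradiction (P⇒R p) ¬r

indicator-true : ∀ {p} {P : Set p} (P? : Dec P) → P → 1 ≤ indicator P?
indicator-true (yes _) p = ≤-refl
indicator-true (no ¬p) p = contradiction p ¬p

count : ∀ {n p} {P : Pred (Fin n) p} → Decidable P → ℕ
count P? = Σℕ (λ i → indicator (P? i))

count-mono : ∀ {n p r} {P : Pred (Fin n) p} {R : Pred (Fin n) r} (P? : Decidable P) (R? : Decidable R) →
  (∀ {i} → P i → R i) → count P? ≤ count R?
count-mono P? R? P⇒R = Σℕ-mono (λ i → indicator-mono (P? i) (R? i) P⇒R)

count-none : ∀ {n p} {P : Pred (Fin n) p} (P? : Decidable P) → (∀ i → ¬ P i) → count P? ≤ 0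
count-none {zero}  P? ¬P = z≤n
count-none {suc n} P? ¬P with P? zero
... | yes p = contradiction p (¬P zero)
... | no  _ = count-none (P? ∘ suc) (¬P ∘ suc)

count-unique : ∀ {n p} {P : Pred (Fin n) p} (P? : Decidable P) →
  (∀ {i j} → i ≢ j → P i → P j → ⊥) → count P? ≤ 1
count-unique {zero}  P? unique = z≤n
count-unique {suc n} P? unique with P? zero
... | yes p = s≤s (count-none (P? ∘ suc) (λ i pi → unique (λ ()) p pi))
... | no  _ = count-unique (P? ∘ suc) (λ i≢j → unique (λ { ≡.refl → i≢j ≡.refl }))

-- The exact size matters: unbiasedness speaks only of output sets with exactly `s ∸ t` elements, so
-- surplus killed rows must be discarded.
subset-of-size : ∀ {n p} {P : Pred (Fin n) p} (P? : Decidable P) t → t ≤ count P? →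
  ∃[ T ] (∣ T ∣ ≡ t × (∀ {i} → i ∈ T → P i))
subset-of-size {zero}  P? zero    t≤c = [] , ≡.refl , λ ()
subset-of-size {suc n} P? zero    t≤c with subset-of-size (P? ∘ suc) zero z≤n
... | T , ∣T∣≡0 , T⊆P = outside ∷ T , ∣T∣≡0 , λ { (there i∈T) → T⊆P i∈T }
subset-of-size {suc n} P? (suc t) t≤c with P? zero
... | yes p with subset-of-size (P? ∘ suc) t (≤-pred t≤c)
...   | T , ∣T∣≡t , T⊆P = inside ∷ T , ≡.cong suc ∣T∣≡t , λ { here → p ; (there i∈T) → T⊆P i∈T }
subset-of-size {suc n} P? (suc t) t≤c | no _ with subset-of-size (P? ∘ suc) (suc t) t≤c
... | T , ∣T∣≡t , T⊆P = outside ∷ T , ∣T∣≡t , λ { (there i∈T) → T⊆P i∈T }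

pair-subset : ∀ {n} {j k : Fin n} → j ≢ k → ∃[ I ] (∣ I ∣ ≡ 2 × j ∈ I × k ∈ I)
pair-subset {j = zero}  {zero}  j≢k = contradiction ≡.refl j≢k
pair-subset {j = zero}  {suc k} j≢k = inside ∷ ⁅ k ⁆ , ≡.cong suc (∣⁅x⁆∣≡1 k) , here , there (x∈⁅x⁆ k)
pair-subset {j = suc j} {zero}  j≢k = inside ∷ ⁅ j ⁆ , ≡.cong suc (∣⁅x⁆∣≡1 j) , there (x∈⁅x⁆ j) , here
pair-subset {j = suc j} {suc k} j≢k with pair-subset {j = j} {k} (λ j≡k → j≢k (≡.cong suc j≡k))
... | I , ∣I∣≡2 , j∈I , k∈I = outside ∷ I , ∣I∣≡2 , there j∈I , there k∈I

module _ {c ℓ : Level} {q : ℕ} (F : FiniteField c ℓ q) where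

  open FiniteField F hiding (zero; +-assoc; +-comm) renaming (_+_ to _+ᶠ_; _*_ to _*ᶠ_; -_ to -ᶠ_;
    *-comm to *ᶠ-comm; +-identityʳ to +ᶠ-identityʳ; *-identityʳ to *ᶠ-identityʳ)
  open SemiringSum semiring using (sum; sum-cong-≋; sum-remove; sum-replicate-zero; ∑-comm;
    ∑-distrib-+; *-distribˡ-sum; *-distribʳ-sum)
  open RingProperties ring using (-‿distribˡ-*; -0#≈0#)
  open SetoidReasoning setoid

  private
    module C = Inverse cardinality

  _≈?_ : ∀ x y → Dec (x ≈ y)
  x ≈? y = map′ (Injection.injective (Inverse⇒Injection cardinality)) C.to-cong (C.to x ≟ C.to y)

  -- Linear algebra over F

  sum-zero : ∀ {n} {f : Fin n → Carrier} → (∀ i → f i ≈ 0#) → sum f ≈ 0#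
  sum-zero {n} f≈0 = trans (sum-cong-≋ f≈0) (sum-replicate-zero n)

  identityMatrix-diag : ∀ {n} (i : Fin n) → identityMatrix F n i i ≈ 1#
  identityMatrix-diag i with i ≟ i
  ... | yes _   = refl
  ... | no  i≢i = contradiction ≡.refl i≢i

  identityMatrix-off : ∀ {n} {i j : Fin n} → i ≢ j → identityMatrix F n i j ≈ 0#
  identityMatrix-off {i = i} {j} i≢j with i ≟ j
  ... | yes i≡j = contradiction i≡j i≢j
  ... | no  _   = refl

  vecMul-identityʳ : ∀ {n} (x : Fin n → Carrier) j → vecMul F x (identityMatrix F n) j ≈ x j
  vecMul-identityʳ {suc n} x j = begin
    sum f                        ≈⟨ sum-remove {i = j} f ⟩
    f j +ᶠ sum (removeAt f j)    ≈⟨ +-cong (trans (*-congˡ (identityMatrix-diag j)) (*ᶠ-identityʳ (x j)))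
                                      (sum-zero (λ i → trans (*-congˡ (identityMatrix-off (punchInᵢ≢i j i))) (zeroʳ _))) ⟩
    x j +ᶠ 0#                    ≈⟨ +ᶠ-identityʳ (x j) ⟩
    x j                          ∎
    where
    f : Fin (suc n) → Carrier
    f i = x i *ᶠ identityMatrix F (suc n) i j

  vecMul-assoc : ∀ {l m n} (x : Fin l → Carrier) (A : Matrix F l m) (B : Matrix F m n) j →
    vecMul F (vecMul F x A) B j ≈ vecMul F x (matMul F A B) j
  vecMul-assoc x A B j = begin
    sum (λ k → sum (λ i → x i *ᶠ A i k) *ᶠ B k j)   ≈⟨ sum-cong-≋ (λ k → *-distribʳ-sum (B k j) (λ i → x i *ᶠ A i k)) ⟩
    sum (λ k → sum (λ i → x i *ᶠ A i k *ᶠ B k j))   ≈⟨ ∑-comm (λ k i → x i *ᶠ A i k *ᶠ B k j) ⟩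
    sum (λ i → sum (λ k → x i *ᶠ A i k *ᶠ B k j))   ≈⟨ sum-cong-≋ (λ i → sum-cong-≋ (λ k → *-assoc (x i) (A i k) (B k j))) ⟩
    sum (λ i → sum (λ k → x i *ᶠ (A i k *ᶠ B k j))) ≈⟨ sum-cong-≋ (λ i → *-distribˡ-sum (x i) (λ k → A i k *ᶠ B k j)) ⟨
    sum (λ i → x i *ᶠ sum (λ k → A i k *ᶠ B k j))   ∎

  -- Moves a functional from two entries of the product `y A` onto the rows of `A`, where killed
  -- rows contribute nothing.
  vecMul-combine : ∀ {m n} (y : Fin m → Carrier) (A : Matrix F m n) u v j k →
    u *ᶠ vecMul F y A j +ᶠ v *ᶠ vecMul F y A k ≈ sum (λ i → y i *ᶠ (u *ᶠ A i j +ᶠ v *ᶠ A i k))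
  vecMul-combine y A u v j k = begin
    u *ᶠ vecMul F y A j +ᶠ v *ᶠ vecMul F y A k
      ≈⟨ +-cong (scale u j) (scale v k) ⟩
    sum (λ i → y i *ᶠ (u *ᶠ A i j)) +ᶠ sum (λ i → y i *ᶠ (v *ᶠ A i k))
      ≈⟨ ∑-distrib-+ (λ i → y i *ᶠ (u *ᶠ A i j)) (λ i → y i *ᶠ (v *ᶠ A i k)) ⟨
    sum (λ i → y i *ᶠ (u *ᶠ A i j) +ᶠ y i *ᶠ (v *ᶠ A i k))
      ≈⟨ sum-cong-≋ (λ i → distribˡ (y i) (u *ᶠ A i j) (v *ᶠ A i k)) ⟨
    sum (λ i → y i *ᶠ (u *ᶠ A i j +ᶠ v *ᶠ A i k)) ∎
    where
    scale : ∀ w l → w *ᶠ vecMul F y A l ≈ sum (λ i → y i *ᶠ (w *ᶠ A i l))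
    scale w l = trans (*-distribˡ-sum w (λ i → y i *ᶠ A i l)) (sum-cong-≋ (λ i →
      trans (sym (*-assoc w (y i) (A i l))) (trans (*-congʳ (*ᶠ-comm w (y i))) (*-assoc (y i) w (A i l)))))

  -- The functionals (u , v) on F², one for each point of the projective line.
  U V : Fin (suc q) → Carrier
  U zero    = 1#
  U (suc c) = -ᶠ C.from c
  V zero    = 0#
  V (suc c) = 1#

  -- Nonvanishing is given by a point where the functional is nonzero; this point later becomes the
  -- prescribed pair of inputs.
  UV-nonzero : ∀ c → ∃[ α ] ∃[ β ] ¬ (U c *ᶠ α +ᶠ V c *ᶠ β ≈ 0#)
  UV-nonzero zero = 1# , 0# , λ eq → 0≉1 (trans (sym eq)
    (trans (+-cong (*ᶠ-identityʳ 1#) (zeroʳ 0#)) (+ᶠ-identityʳ 1#)))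
  UV-nonzero (suc c) = 0# , 1# , λ eq → 0≉1 (trans (sym eq)
    (trans (+-cong (zeroʳ _) (*ᶠ-identityʳ 1#)) (+-identityˡ 1#)))

  -- The functional `(1 , 0)` handles `a ≈ 0#`; otherwise `(- b / a , 1)` does.
  UV-kills-some : ∀ a b → ∃[ c ] (U c *ᶠ a +ᶠ V c *ᶠ b ≈ 0#)
  UV-kills-some a b with a ≈? 0#
  ... | yes a≈0 = zero , trans (+-cong (trans (*-congˡ a≈0) (zeroʳ 1#)) (zeroˡ b)) (+ᶠ-identityʳ 0#)
  ... | no  a≉0 with inverse a a≉0
  ...   | a⁻¹ , aa⁻¹≈1 = suc (C.to (b *ᶠ a⁻¹)) , (begin
    -ᶠ C.from (C.to (b *ᶠ a⁻¹)) *ᶠ a +ᶠ 1# *ᶠ b ≈⟨ +-cong (*-congʳ (-‿cong (C.strictlyInverseʳ (b *ᶠ a⁻¹)))) (*-identityˡ b) ⟩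
    -ᶠ (b *ᶠ a⁻¹) *ᶠ a +ᶠ b                     ≈⟨ +-congʳ (-‿distribˡ-* (b *ᶠ a⁻¹) a) ⟨
    -ᶠ (b *ᶠ a⁻¹ *ᶠ a) +ᶠ b                     ≈⟨ +-congʳ (-‿cong (trans (*-assoc b a⁻¹ a)
                                                    (trans (*-congˡ (trans (*ᶠ-comm a⁻¹ a) aa⁻¹≈1)) (*ᶠ-identityʳ b)))) ⟩
    -ᶠ b +ᶠ b                                   ≈⟨ -‿inverseˡ b ⟩
    0#                                          ∎)

  -- Rows of M killed by a functional

  module _ {t s : ℕ} (A : LinearAONT F 2 t s) where

    open LinearAONT A

    Killed : Carrier → Carrier → Fin s → Fin s → Fin s → Set ℓ
    Killed u v j k i = u *ᶠ M i j +ᶠ v *ᶠ M i k ≈ 0#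

    killed? : ∀ u v j k → Decidable (Killed u v j k)
    killed? u v j k i = (u *ᶠ M i j +ᶠ v *ᶠ M i k) ≈? 0#

    input-from-output : ∀ x j → x j ≈ vecMul F (vecMul F x M⁻¹) M j
    input-from-output x j = begin
      x j                               ≈⟨ vecMul-identityʳ x j ⟨
      vecMul F x (identityMatrix F s) j ≈⟨ sum-cong-≋ (λ i → *-congˡ (inverseˡ i j)) ⟨
      vecMul F x (matMul F M⁻¹ M) j     ≈⟨ vecMul-assoc x M⁻¹ M j ⟨
      vecMul F (vecMul F x M⁻¹) M j     ∎

    -- The fibre over (0 , 0) contains 0, hence μ ≠ 0 and every fibre is inhabited.
    fibre-inhabited : ∀ {I J : Subset s} → ∣ I ∣ ≡ 2 → ∣ J ∣ ≡ s ∸ t →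
      (a : Fin s → Carrier) →
      ∃[ x ] ((∀ i → i ∈ I → x i ≈ a i) × (∀ j → j ∈ J → vecMul F x M⁻¹ j ≈ 0#))
    fibre-inhabited {I} {J} ∣I∣≡2 ∣J∣≡s∸t a with unbiased I J ∣I∣≡2 ∣J∣≡s∸t
    ... | μ , fibres = Inverse.from (fibres (λ i _ → a i) (λ _ _ → 0#)) (Inverse.to (fibres (λ _ _ → 0#) (λ _ _ → 0#))
      ((λ _ → 0#) , (λ _ _ → refl) , (λ j _ → sum-zero (λ i → zeroˡ (M⁻¹ i j)))))

    -- Given `t` killed rows `T`, unbiasedness allows inputs `α`, `β` at `j`, `k` together with
    -- outputs `y` vanishing off `T`. As `x = y M`, the value of the functional at `(α , β)` is a
    -- combination of the rows in `T` only, each of which it kills, so that value is zero.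
    killed-count : ∀ {j k} → j ≢ k → ∀ u v → ∃[ α ] ∃[ β ] ¬ (u *ᶠ α +ᶠ v *ᶠ β ≈ 0#) →
      count (killed? u v j k) < t
    killed-count {j} {k} j≢k u v (α , β , uα+vβ≉0) = ≰⇒> absurd
      where
      a : Fin s → Carrier
      -- Only the values at `j` and `k` matter; `β` elsewhere is an arbitrary default.
      a i = if does (i ≟ j) then α else β

      aj≈α : a j ≈ α
      aj≈α = reflexive (≡.cong (if_then α else β) (dec-true (j ≟ j) ≡.refl))

      ak≈β : a k ≈ β
      ak≈β = reflexive (≡.cong (if_then α else β) (dec-false (k ≟ j) (j≢k ∘ ≡.sym)))

      absurd : t ≤ count (killed? u v j k) → ⊥
      absurd t≤count with subset-of-size (killed? u v j k) t t≤count | pair-subset j≢k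
      ... | T , ∣T∣≡t , T-killed | I , ∣I∣≡2 , j∈I , k∈I
        with fibre-inhabited {I} {∁ T} ∣I∣≡2 (≡.trans (∣∁p∣≡n∸∣p∣ T) (≡.cong (s ∸_) ∣T∣≡t)) a
      ...   | x , x-on-I , y-off-T = uα+vβ≉0 (begin
        u *ᶠ α +ᶠ v *ᶠ β                           ≈⟨ +-cong (*-congˡ (coordinate j∈I aj≈α)) (*-congˡ (coordinate k∈I ak≈β)) ⟨
        u *ᶠ vecMul F y M j +ᶠ v *ᶠ vecMul F y M k ≈⟨ vecMul-combine y M u v j k ⟩
        sum (λ i → y i *ᶠ (u *ᶠ M i j +ᶠ v *ᶠ M i k)) ≈⟨ sum-zero vanishes ⟩
        0#                                         ∎)
        where
        y : Fin s → Carrier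
        y = vecMul F x M⁻¹

        coordinate : ∀ {i γ} → i ∈ I → a i ≈ γ → vecMul F y M i ≈ γ
        coordinate {i} i∈I ai≈γ = trans (sym (input-from-output x i)) (trans (x-on-I i i∈I) ai≈γ)

        vanishes : ∀ i → y i *ᶠ (u *ᶠ M i j +ᶠ v *ᶠ M i k) ≈ 0#
        vanishes i with i ∈? T
        ... | yes i∈T = trans (*-congˡ (T-killed i∈T)) (zeroʳ (y i))
        ... | no  i∉T = trans (*-congʳ (y-off-T i (x∉p⇒x∈∁p i∉T))) (zeroˡ _)

    zero? : ∀ j i → Dec (M i j ≈ 0#)
    zero? j i = M i j ≈? 0#

    -- Double counting of rows and functionals for two columns

    module _ {j k : Fin s} (j≢k : j ≢ k) where

      directionCount : Fin (suc q) → ℕ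
      directionCount c = count (killed? (U c) (V c) j k)

      directionCount<t : ∀ c → directionCount c < t
      directionCount<t c = killed-count j≢k (U c) (V c) (UV-nonzero c)

      rowCount : Fin s → ℕ
      rowCount i = count (λ c → killed? (U c) (V c) j k i)

      rowCount≥1 : ∀ i → 1 ≤ rowCount i
      rowCount≥1 i with UV-kills-some (M i j) (M i k)
      ... | c , killed = ≤-trans (indicator-true (killed? (U c) (V c) j k i) killed)
                           (term≤Σℕ (λ c → indicator (killed? (U c) (V c) j k i)) c)

      rowCount-zero-row : ∀ {i} → M i j ≈ 0# → M i k ≈ 0# → suc q ≤ rowCount i
      rowCount-zero-row {i} Mij≈0 Mik≈0 = ≤-trans (≤-reflexive (≡.sym (*-identityʳ (suc q))))
        (Σℕ-lower (λ c → indicator-true (killed? (U c) (V c) j k i)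
          (trans (+-cong (trans (*-congˡ Mij≈0) (zeroʳ _)) (trans (*-congˡ Mik≈0) (zeroʳ _))) (+ᶠ-identityʳ 0#))))

      ΣrowCount≡ΣdirectionCount : Σℕ rowCount ≡ Σℕ directionCount
      ΣrowCount≡ΣdirectionCount = Σℕ-comm (λ i c → indicator (killed? (U c) (V c) j k i))

      -- The zero row is killed `suc q` times and every other row at least once, while each of the
      -- `suc q` functionals kills at most `t ∸ 1` rows.
      zero-row-bound : ∀ {i} → M i j ≈ 0# → M i k ≈ 0# → s + q ≤ suc q * (t ∸ 1)
      zero-row-bound {i} Mij≈0 Mik≈0 = ≤-trans (Σℕ-lower-at i rowCount≥1 (rowCount-zero-row Mij≈0 Mik≈0))
        (≤-trans (≤-reflexive ΣrowCount≡ΣdirectionCount) (Σℕ-upper (λ c → <⇒≤pred (directionCount<t c))))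

      column-zeros-bound : s ≤ (count (zero? j) + count (zero? k)) + (q ∸ 1) * (t ∸ 1)
      column-zeros-bound = ≤R.begin
        s                                             ≤R.≡⟨ *-identityʳ s ⟨
        s * 1                                         ≤R.≤⟨ Σℕ-lower rowCount≥1 ⟩
        Σℕ rowCount                                   ≤R.≡⟨ ΣrowCount≡ΣdirectionCount ⟩
        directionCount zero + Σℕ (directionCount ∘ suc) ≤R.≤⟨ +-mono-≤ first (≤-trans
                                                         -- `suc (C.to 0#)` indexes the functional
                                                         -- `(0 , 1)`, up to `≈`; `q ∸ 1`
                                                         -- functionals remain besides the two
                                                         -- coordinate ones.
                                                         (Σℕ-upper-at (C.to 0#) (λ c → <⇒≤pred (directionCount<t (suc c))))
                                                         (+-monoˡ-≤ _ second)) ⟩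
        count (zero? j) + (count (zero? k) + (q ∸ 1) * (t ∸ 1)) ≤R.≡⟨ +-assoc (count (zero? j)) _ _ ⟨
        (count (zero? j) + count (zero? k)) + (q ∸ 1) * (t ∸ 1) ≤R.∎
        where
        module ≤R = ≤-Reasoning

        first : directionCount zero ≤ count (zero? j)
        first = count-mono (killed? 1# 0# j k) (zero? j) (λ {i} killed →
          trans (sym (trans (+-cong (*-identityˡ (M i j)) (zeroˡ (M i k))) (+ᶠ-identityʳ (M i j)))) killed)

        second : directionCount (suc (C.to 0#)) ≤ count (zero? k)
        second = count-mono (killed? (-ᶠ C.from (C.to 0#)) 1# j k) (zero? k) (λ {i} killed →
          trans (sym (trans (+-cong (-from0*x≈0 (M i j)) (*-identityˡ (M i k))) (+-identityˡ (M i k)))) killed)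
          where
          -from0*x≈0 : ∀ x → -ᶠ C.from (C.to 0#) *ᶠ x ≈ 0#
          -from0*x≈0 x = begin
            -ᶠ C.from (C.to 0#) *ᶠ x ≈⟨ *-congʳ (-‿cong (C.strictlyInverseʳ 0#)) ⟩
            -ᶠ 0# *ᶠ x               ≈⟨ *-congʳ -0#≈0# ⟩
            0# *ᶠ x                  ≈⟨ zeroˡ x ⟩
            0#                       ∎

    -- Exchanging the sums counts the zeros row by row, and each row has at most one.
    total-zeros : (∀ {i j k} → j ≢ k → M i j ≈ 0# → M i k ≈ 0# → ⊥) → Σℕ (λ j → count (zero? j)) ≤ s
    total-zeros no-zero-row = ≤-trans (≤-reflexive (Σℕ-comm (λ j i → indicator (zero? j i))))
      (≤-trans (Σℕ-upper (λ i → count-unique (λ j → zero? j i) no-zero-row)) (≤-reflexive (*-identityʳ s)))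

    zero-row? : Dec (∃[ i ] ∃[ j ] ∃[ k ] (j ≢ k × M i j ≈ 0# × M i k ≈ 0#))
    zero-row? = any? (λ i → any? (λ j → any? (λ k → ¬? (j ≟ k) ×-dec zero? j i ×-dec zero? k i)))

-- The two bounds combined

mainTheorem17 : ∀ {c ℓ : Level} (q : ℕ) → IsPrimePower q →
    (F : FiniteField c ℓ q) (tₒ s : ℕ) → 2 ≤ tₒ →
    LinearAONT F 2 tₒ s →
    s ≤ (1 + (tₒ ∸ 2) * (q + 1)) ⊔ (2 + (tₒ ∸ 1) * (q ∸ 1))
mainTheorem17 q _ F (suc (suc r)) s (s≤s (s≤s z≤n)) A with zero-row? F A
-- With `tₒ = 2 + r`, the right side `suc q * suc r` of the zero-row bound equals
-- `q + (1 + r * (q + 1))`, so `q` cancels.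
... | yes (i , j , k , j≢k , Mij≈0 , Mik≈0) = m≤n⇒m≤n⊔o (2 + suc r * (q ∸ 1)) (+-cancelˡ-≤ q _ _
  (≤-trans (≤-reflexive (+-comm q s)) (≤-trans (zero-row-bound F A j≢k Mij≈0 Mik≈0) (≤-reflexive (identity q r)))))
  where
  identity : ∀ q r → suc q * suc r ≡ q + (1 + r * (q + 1))
  identity = solve-∀
... | no no-zero-row = m≤n⇒m≤o⊔n (1 + r * (q + 1)) (second-bound s A (LinearAONT.tᵢ≤s A)
        (total-zeros F A (λ j≢k Mij≈0 Mik≈0 → no-zero-row (_ , _ , _ , j≢k , Mij≈0 , Mik≈0))))
  where
  -- Generalising over `s` and `A` lets `2 ≤ s` be matched, exposing the shape `2 + m` that
  -- `pair-with-small-sum` expects.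
  second-bound : ∀ s (A : LinearAONT F 2 (2 + r) s) → 2 ≤ s → Σℕ (λ j → count (zero? F A j)) ≤ s →
    s ≤ 2 + suc r * (q ∸ 1)
  second-bound (suc (suc _)) A (s≤s (s≤s z≤n)) Σz≤s with pair-with-small-sum (λ j → count (zero? F A j)) Σz≤s
  ... | j , k , j≢k , zj+zk≤2 = ≤-trans (column-zeros-bound F A j≢k)
          (+-mono-≤ zj+zk≤2 (≤-reflexive (*-comm (q ∸ 1) (suc r))))
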